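{- Let $n\ge 1$, let $\mathcal N=(N_1,\ldots,N_n)$ be a Grassmann necklace in $\binom{[n]}{r}$, let $X\in \mathcal{O}ut(\mathcal N)$ and let $Y\in \mathcal{I}nt(\mathcal N)$. Then $X$ and $Y$ are weakly separated, i.e. $X\| Y$.
   Context: $[n]=\{1,\ldots,n\}$, regarded as $\mathbb Z$ modulo $n$; $\binom{[n]}{r}$ is the set of $r$-element subsets of $[n]$. For $i\in[n]$, $<_i$ is the cyclically shifted order $i<_i i+1<_i\cdots<_i n<_i 1<_i\cdots<_i i-1$. For $X,Y\in\binom{[n]}{r}$, write $X\ll_i Y$ if $x<_i y$ for all $x\in X-Y$ and $y\in Y-X$ (set differences). $X$ and $Y$ are weakly separated, written $X\|Y$, if $X\ll_j Y$ for some $j\in[n]$. A (Grassmann) necklace in $\binom{[n]}{r}$ is a family $\mathcal N=(N_1,\ldots,N_n)$ of sets in $\binom{[n]}{r}$ such that $N_{i+1}\supseteq N_i-\{i\}$ for each $i$ (indices modulo $n$). Standing assumption: $i\in N_i$ for every $i\in[n]$. The interior of $\mathcal N$ is $\mathcal{I}nt(\mathcal N)=\{X\in\binom{[n]}{r} : N_i\ll_i X \text{ for every } i\in[n]\}$. Put $\mathcal S(\mathcal N)=\{X\in\binom{[n]}{r} : X\|N_i \text{ for all } i\in[n]\}$. One has $\mathcal{I}nt(\mathcal N)\subseteq\mathcal S(\mathcal N)$, and the exterior of $\mathcal N$ is $\mathcal{O}ut(\mathcal N)=\mathcal S(\mathcal N)\setminus\mathcal{I}nt(\mathcal N)$. 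-}

module Defs where

open import Data.Fin.Base using (Fin; toℕ; _≤_; _<_)
open import Data.Fin.Subset using (Subset; _∈_; _⊇_; _-_; _─_; ∣_∣)
open import Data.Nat.Base using (ℕ; suc; NonZero)
open import Data.Nat.DivMod using (_mod_)
open import Data.Product.Base using (∃; _×_)
open import Level using (0ℓ)
open import Relation.Binary.PropositionalEquality.Core using (_≡_)
open import Relation.Unary using (Pred; _∖_)

-- [n] is Fin n, the element k ∈ {1, …, n} being represented by k - 1.

-- The cyclic successor i ↦ i + 1 modulo n.
next : ∀ {n} .{{_ : NonZero n}} → Fin n → Fin n
next {n} i = suc (toℕ i) mod n

-- The shifted order i <ᵢ i+1 <ᵢ ⋯ <ᵢ n <ᵢ 1 <ᵢ ⋯ <ᵢ i-1: the block
-- {i, …, n} in its usual order, followed by {1, …, i-1} in its usual order.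
data _<[_]_ {n : ℕ} (x i y : Fin n) : Set where
  first  : i ≤ x → x < y → x <[ i ] y
  second : x < y → y < i → x <[ i ] y
  across : i ≤ x → y < i → x <[ i ] y

_≪[_]_ : ∀ {n} → Subset n → Fin n → Subset n → Set
X ≪[ i ] Y = ∀ x y → x ∈ X ─ Y → y ∈ Y ─ X → x <[ i ] y

_∥_ : ∀ {n} → Subset n → Subset n → Set
X ∥ Y = ∃ λ j → X ≪[ j ] Y

infix 4 _<[_]_ _≪[_]_ _∥_

Layer : ∀ {n} → ℕ → Pred (Subset n) 0ℓ
Layer r X = ∣ X ∣ ≡ r

record Necklace (n r : ℕ) .{{_ : NonZero n}} : Set where
  field
    set      : Fin n → Subset n
    layer    : ∀ i → Layer r (set i)
    exchange : ∀ i → set (next i) ⊇ (set i - i)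

open Necklace public

module _ {n r : ℕ} .{{_ : NonZero n}} (N : Necklace n r) where

  Int : Pred (Subset n) 0ℓ
  Int X = Layer r X × (∀ i → set N i ≪[ i ] X)

  𝒮 : Pred (Subset n) 0ℓ
  𝒮 X = Layer r X × (∀ i → X ∥ set N i)

  Out : Pred (Subset n) 0ℓ
  Out = 𝒮 ∖ Int

{-# OPTIONS --safe #-}
module Submission where

open import Data.Bool.Base using (Bool; true; false; if_then_else_)
open import Data.Empty using (⊥; ⊥-elim)
open import Data.Fin.Base as Fin using (Fin; toℕ; zero; suc)
open import Data.Fin.Properties as Fin using (toℕ-injective; toℕ-fromℕ<; toℕ<n)
open import Data.Fin.Subset using (Subset; _∈_; _∉_; _─_; ∣_∣; outside)
open import Data.Fin.Subset.Properties using (x∈p∧x∉q⇒x∈p─q; x∈p∧x≢y⇒x∈p-y)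
open import Data.Nat.Base
open import Data.Nat.DivMod
open import Data.Nat.Properties
open import Data.Product.Base using (∃; _×_; _,_; proj₁; proj₂)
open import Data.Sum.Base using (_⊎_; inj₁; inj₂)
open import Data.Vec.Base using ([]; _∷_; lookup; here; there)
open import Data.Vec.Properties using ([]=⇒lookup; lookup⇒[]=)
open import Relation.Binary.Definitions using (tri<; tri≈; tri>)
open import Relation.Binary.PropositionalEquality
open import Relation.Nullary using (¬_; Dec; yes; no)
open import Defs

-- If X ∈ Out N, then a single θ satisfies X ≪[ θ ] N_m for all m. Indeed some cyclic
-- interval I contains more elements of X than of any N_m, so every X \ N_m meets I and every
-- N_m \ X meets its complement; the left end of I is first shrunk to an element that really
-- leaves the necklace, then extended over elements of X up to θ. Reading m as time, an element
-- e of N_m \ X stays until time e, and an element e of X \ N_m has been missing since time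
-- e + 1; following elements to these times shows that no element of N_m \ X precedes one of
-- X \ N_m in the order from θ.
-- Then X ≪[ θ ] Y for Y ∈ Int N: if u ∈ Y \ X preceded v ∈ X \ Y, then u ∈ N_m would imply
-- v ∈ N_m, and conversely for m outside (u, v]. As v is absent at time v + 1, so is u, and from
-- then until time u both would have to enter in one step, but a step adds only one element.

-- Boolean sequences and counting on intervals of ℕ.

_∖_ : (ℕ → Bool) → (ℕ → Bool) → ℕ → Set
(f ∖ g) p = f p ≡ true × g p ≡ false

infixl 6 _∖_

false≢true : ∀ {b} → b ≡ false → b ≡ true → ⊥
false≢true refl ()

≢true⇒false : ∀ {b} → ¬ b ≡ true → b ≡ false
≢true⇒false {false} _ = refl
≢true⇒false {true}  h = ⊥-elim (h refl)

bit : Bool → ℕ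
bit b = if b then 1 else 0

count : (ℕ → Bool) → ℕ → ℕ → ℕ
count f a zero    = 0
count f a (suc l) = bit (f a) + count f (suc a) l

bit-mono : ∀ {b c} → (b ≡ true → c ≡ true) → bit b ≤ bit c
bit-mono {false}        _ = z≤n
bit-mono {true} {true}  _ = ≤-refl
bit-mono {true} {false} h with () ← h refl

-- Membership in `[a, a + l)`, built along the recursion of `count` so that proofs about counts can
-- match on it.
data InRange (a : ℕ) : ℕ → ℕ → Set where
  here  : ∀ {l} → InRange a (suc l) a
  there : ∀ {l p} → InRange (suc a) l p → InRange a (suc l) p

lower : ∀ {a l p} → InRange a l p → a ≤ p
lower here      = ≤-refl
lower (there i) = <⇒≤ (lower i)

upper : ∀ {a l p} → InRange a l p → p < a + l
upper {a} {suc l} here      = m<m+n a (s≤s z≤n)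
upper {a} {suc l} (there i) = <-≤-trans (upper i) (≤-reflexive (sym (+-suc a l)))

inRange : ∀ {a l p} → a ≤ p → p < a + l → InRange a l p
inRange {a} {zero} a≤p p<a = ⊥-elim (<⇒≱ (<-≤-trans p<a (≤-reflexive (+-identityʳ a))) a≤p)
inRange {a} {suc l} a≤p p<a with m≤n⇒m<n∨m≡n a≤p
... | inj₁ a<p  = there (inRange a<p (<-≤-trans p<a (≤-reflexive (+-suc a l))))
... | inj₂ refl = here

count-mono : ∀ {f g} a l → (∀ {p} → InRange a l p → f p ≡ true → g p ≡ true) →
             count f a l ≤ count g a l
count-mono a zero    h = z≤n
count-mono a (suc l) h = +-mono-≤ (bit-mono (h here)) (count-mono (suc a) l (λ i → h (there i)))

count-++ : ∀ f a k l → count f a (k + l) ≡ count f a k + count f (a + k) l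
count-++ f a zero    l = cong (λ b → count f b l) (sym (+-identityʳ a))
count-++ f a (suc k) l = begin
  bit (f a) + count f (suc a) (k + l)                       ≡⟨ cong (bit (f a) +_) (count-++ f (suc a) k l) ⟩
  bit (f a) + (count f (suc a) k + count f (suc a + k) l)   ≡⟨ +-assoc (bit (f a)) _ _ ⟨
  bit (f a) + count f (suc a) k + count f (suc a + k) l     ≡⟨ cong (λ b → bit (f a) + count f (suc a) k + count f b l) (+-suc a k) ⟨
  bit (f a) + count f (suc a) k + count f (a + suc k) l     ∎
  where open ≡-Reasoning

count-shift : ∀ f s a l → count (λ p → f (s + p)) a l ≡ count f (s + a) l
count-shift f s a zero    = refl
count-shift f s a (suc l) = cong (bit (f (s + a)) +_)
  (trans (count-shift f s (suc a) l) (cong (λ b → count f b l) (+-suc s a)))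

remove : ℕ → (ℕ → Bool) → ℕ → Bool
remove e f p with p ≟ e
... | yes _ = false
... | no  _ = f p

remove-⊆ : ∀ e f {p} → remove e f p ≡ true → f p ≡ true × p ≢ e
remove-⊆ e f {p} h with p ≟ e
... | no p≢e = h , p≢e

remove-self : ∀ e f → remove e f e ≡ false
remove-self e f with e ≟ e
... | yes _   = refl
... | no e≢e = ⊥-elim (e≢e refl)

remove-other : ∀ e f {p} → p ≢ e → remove e f p ≡ f p
remove-other e f {p} p≢e with p ≟ e
... | yes p≡e = ⊥-elim (p≢e p≡e)
... | no _    = refl

count-remove-< : ∀ {f a l e} → InRange a l e → f e ≡ true → count (remove e f) a l < count f a l
count-remove-< {f} {a} {suc l} here fe rewrite remove-self a f | fe =
  s≤s (count-mono (suc a) l (λ _ h → proj₁ (remove-⊆ a f h)))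
count-remove-< {f} {a} {suc l} {e} (there i) fe =
  +-mono-≤-< (bit-mono (λ h → proj₁ (remove-⊆ e f h))) (count-remove-< i fe)

count-remove-≤ : ∀ f e a l → count f a l ≤ suc (count (remove e f) a l)
count-remove-≤ f e a zero    = z≤n
count-remove-≤ f e a (suc l) with a ≟ e
... | yes refl = +-mono-≤ (bit≤1 (f a)) (count-mono (suc a) l keep)
  where
  bit≤1 : ∀ b → bit b ≤ 1
  bit≤1 true  = ≤-refl
  bit≤1 false = z≤n
  keep : ∀ {p} → InRange (suc a) l p → f p ≡ true → remove a f p ≡ true
  keep i h = trans (remove-other a f (≢-sym (<⇒≢ (lower i)))) h
... | no _ = ≤-trans (+-monoʳ-≤ (bit (f a)) (count-remove-≤ f e (suc a) l)) (≤-reflexive (+-suc (bit (f a)) _))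

count-<⇒∃ : ∀ {f g} a l → count f a l < count g a l → ∃ λ p → InRange a l p × (g ∖ f) p
count-<⇒∃ {f} {g} a (suc l) lt with g a in ga | f a in fa
... | true  | false = a , here , ga , fa
... | true  | true  with p , i , d ← count-<⇒∃ (suc a) l (s≤s⁻¹ lt) = p , there i , d
... | false | false with p , i , d ← count-<⇒∃ (suc a) l lt = p , there i , d
... | false | true  with p , i , d ← count-<⇒∃ (suc a) l (<-trans (n<1+n _) lt) = p , there i , d

-- Deleting `e` from `f` makes the inequality strict; the element then found differs from `e`
-- because `g e` is false.
count-≤⇒∃ : ∀ {f g a l e} → count f a l ≤ count g a l → InRange a l e → (f ∖ g) e →
            ∃ λ z → InRange a l z × (g ∖ f) z
count-≤⇒∃ {f} {g} {a} {l} {e} le i (fe , ge)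
  with z , j , gz , r ← count-<⇒∃ a l (<-≤-trans (count-remove-< i fe) le) =
  z , j , gz , trans (sym (remove-other e f λ { refl → false≢true ge gz })) r

-- The surplus of `g` together with the element `e` of `f ∖ g` forces two elements of `g ∖ f`, so
-- one of them is not `b`.
count-<⇒∃-avoiding : ∀ {f g a l e} b → count f a l < count g a l → InRange a l e → (f ∖ g) e →
                     ∃ λ z → InRange a l z × (g ∖ f) z × z ≢ b
count-<⇒∃-avoiding {f} {g} {a} {l} {e} b lt i (fe , ge)
  with z , j , r , fz ← count-≤⇒∃ {g = remove b g} (s≤s⁻¹ (≤-trans lt (count-remove-≤ g b a l))) i
         (fe , ≢true⇒false λ h → false≢true ge (proj₁ (remove-⊆ b g h))) =
  z , j , (proj₁ (remove-⊆ b g r) , fz) , proj₂ (remove-⊆ b g r)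

-- Positions and times run over one window of the cyclic order, rotated so that it starts at 0.
-- The initial block [0, k) holds more elements of x than of any N m, and d is an element
-- of it that really leaves the necklace at time d.
module Exterior
  (n : ℕ) (x : ℕ → Bool) (N : ℕ → ℕ → Bool)
  (exch : ∀ {m p} → m < n → p < n → p ≢ m → N m p ≡ true → N (suc m) p ≡ true)
  (own  : ∀ {m} → m < n → N m m ≡ true)
  (wrap : ∀ p → N n p ≡ N 0 p)
  (stay : ∀ {m p} → m < n → p < n → N (suc m) m ≡ true → N (suc m) p ≡ N m p)
  (uncrossed : ∀ {m p q r s} → m ≤ n → p < q → q < r → r < s → s < n →
               (x ∖ N m) p → (N m ∖ x) q → (x ∖ N m) r → (N m ∖ x) s → ⊥)
  (k l : ℕ) (k+l≡n : k + l ≡ n)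
  (dense  : ∀ {m} → m ≤ n → count (N m) 0 k < count x 0 k)
  (sparse : ∀ {m} → m ≤ n → count x k l < count (N m) k l)
  (d : ℕ) (d<k : d < k)
  (x-initial : ∀ {p} → p ≤ d → x p ≡ true)
  (d-leaves : N (suc d) d ≡ false)
  (x-last : ∀ {p} → suc p ≡ n → x p ≡ false)
  where

  k≤n : k ≤ n
  k≤n = subst (k ≤_) k+l≡n (m≤m+n k l)

  left : ∀ {p} → p < k → InRange 0 k p
  left = inRange z≤n

  right : ∀ {p} → k ≤ p → p < n → InRange k l p
  right k≤p p<n = inRange k≤p (subst (_ <_) (sym k+l≡n) p<n)

  right< : ∀ {p} → InRange k l p → p < n
  right< i = subst (_ <_) k+l≡n (upper i)

  minus-left : ∀ {m} → m ≤ n → ∃ λ p → p < k × (x ∖ N m) p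
  minus-left m≤n with p , i , h ← count-<⇒∃ 0 k (dense m≤n) = p , upper i , h

  plus-right : ∀ {m} → m ≤ n → ∃ λ p → k ≤ p × p < n × (N m ∖ x) p
  plus-right m≤n with p , i , h ← count-<⇒∃ k l (sparse m≤n) = p , lower i , right< i , h

  x∖N-back : ∀ {m p} → m < n → p < n → p ≢ m → (x ∖ N (suc m)) p → (x ∖ N m) p
  x∖N-back m<n p<n p≢m (xp , np) = xp , ≢true⇒false λ h → false≢true np (exch m<n p<n p≢m h)

  N∖x-forth : ∀ {m p} → m < n → p < n → p ≢ m → (N m ∖ x) p → (N (suc m) ∖ x) p
  N∖x-forth m<n p<n p≢m (np , xp) = exch m<n p<n p≢m np , xp

  -- Induction forward in time, starting from `d`, which has just left. If `m` lies outside `x`, an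
  -- element of `x ∖ N (suc m)` in `[0, k)` must come before `m`: beyond `m` it would complete a
  -- crossing with `p`, `m` and some `w` right of `k`.
  x∖N-before : ∀ j → let m = suc d + j in m ≤ k → ∃ λ p → p < m × (x ∖ N m) p
  x∖N-before zero    _   rewrite +-identityʳ d = d , n<1+n d , x-initial ≤-refl , d-leaves
  x∖N-before (suc j) m≤k rewrite +-suc d j = step
    where
    m = suc d + j
    m<k : m < k
    m<k = m≤k
    m<n = <-≤-trans m<k k≤n
    step : ∃ λ p → p < suc m × (x ∖ N (suc m)) p
    step with x m in xm | N (suc m) m in nm | x∖N-before j (<⇒≤ m<k)
    ... | true  | false | _ = m , n<1+n m , xm , nm
    ... | true  | true  | p , p<m , xp , np =
      p , m<n⇒m<1+n p<m , xp , trans (stay m<n (<-trans p<m m<n) nm) np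
    ... | false | _     | p , p<m , hp
      with z , z<k , hz ← minus-left m<n | w , k≤w , w<n , hw ← plus-right (<⇒≤ m<n)
      with <-cmp z m
    ... | tri< z<m _ _ = z , m<n⇒m<1+n z<m , hz
    ... | tri≈ _ refl _ = ⊥-elim (false≢true xm (proj₁ hz))
    ... | tri> _ z≢m m<z = ⊥-elim (uncrossed (<⇒≤ m<n) p<m m<z (<-≤-trans z<k k≤w) w<n
            hp (own m<n , xm) (x∖N-back m<n (<-≤-trans z<k k≤n) z≢m hz) hw)

  -- The mirror image, by induction backwards from the last time `n - 1`, where `own` and `x-last`
  -- give the witness.
  N∖x-after : ∀ j {m} → m + suc j ≡ n → k ≤ m → ∃ λ p → m ≤ p × p < n × (N m ∖ x) p
  N∖x-after zero    {m} eq k≤m = m , ≤-refl , m<n , own m<n , x-last 1+m≡n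
    where
    1+m≡n = trans (sym (+-comm m 1)) eq
    m<n = ≤-reflexive 1+m≡n
  N∖x-after (suc j) {m} eq k≤m = step
    where
    1+m+1+j≡n = trans (sym (+-suc m (suc j))) eq
    1+m<n : suc m < n
    1+m<n = subst (suc m <_) 1+m+1+j≡n (m<m+n (suc m) (s≤s z≤n))
    m<n = <-trans (n<1+n m) 1+m<n
    step : ∃ λ p → m ≤ p × p < n × (N m ∖ x) p
    step with x m in xm | N (suc m) m in nm | N∖x-after j 1+m+1+j≡n (m≤n⇒m≤1+n k≤m)
    ... | false | _     | _ = m , ≤-refl , m<n , own m<n , xm
    ... | true  | true  | w , m<w , w<n , nw , xw =
      w , <⇒≤ m<w , w<n , trans (sym (stay m<n w<n nm)) nw , xw
    ... | true  | false | w , m<w , w<n , hw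
      with z , k≤z , z<n , hz ← plus-right (<⇒≤ m<n) | u , u<k , hu ← minus-left m<n
      with <-cmp z m
    ... | tri> _ _ m<z = z , <⇒≤ m<z , z<n , hz
    ... | tri≈ _ refl _ = ⊥-elim (false≢true (proj₂ hz) xm)
    ... | tri< z<m z≢m _ = ⊥-elim (uncrossed m<n (<-≤-trans u<k k≤z) z<m m<w w<n
            hu (N∖x-forth m<n z<n z≢m hz) (xm , nm) hw)

  -- Persists from time m until time e: an element of x ∖ N (m + 1) before e could only be m; since
  -- nothing crosses, x ∖ N (m + 1) would then meet [0, k) in m alone, contradicting dense.
  Leading : ℕ → ℕ → Set
  Leading e m = (N m ∖ x) e × (∀ {p} → p < e → ¬ (x ∖ N m) p)

  leading-step : ∀ {e m} → e < k → m < n → e ≢ m → Leading e m → Leading e (suc m)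
  leading-step {e} {m} e<k m<n e≢m (he , none) = he′ , none′
    where
    e<n = <-≤-trans e<k k≤n
    he′ = N∖x-forth m<n e<n e≢m he
    none′ : ∀ {p} → p < e → ¬ (x ∖ N (suc m)) p
    none′ {p} p<e hp with p ≟ m
    ... | no p≢m = none p<e (x∖N-back m<n (<-trans p<e e<n) p≢m hp)
    ... | yes refl
      -- Since `e` lies in `N (suc m) ∖ x` inside `[0, k)`, `dense` yields two elements of
      -- `x ∖ N (suc m)` there, one of them besides `m`.
      with z , i , hz , z≢m ← count-<⇒∃-avoiding m (dense m<n) (left e<k) he′
         | w , k≤w , w<n , hw ← plus-right m<n
      with <-cmp z e
    ... | tri< z<e _ _ = none z<e (x∖N-back m<n (<-trans z<e e<n) z≢m hz)
    ... | tri≈ _ refl _ = false≢true (proj₂ he) (proj₁ hz)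
    ... | tri> _ _ e<z = uncrossed m<n p<e e<z (<-≤-trans (upper i) k≤w) w<n hp he′ hz hw

  leading-iterate : ∀ {e} j {m m′} → e < k → m + j ≡ m′ → m′ ≤ n → (e < m ⊎ m′ ≤ e) →
                    Leading e m → Leading e m′
  leading-iterate zero    {m} e<k refl _ _ h = subst (Leading _) (sym (+-identityʳ m)) h
  leading-iterate {e} (suc j) {m} {m′} e<k eq m′≤n far h =
    leading-iterate j e<k eq′ m′≤n (far′ far) (leading-step e<k (<-≤-trans m<m′ m′≤n) (e≢m far) h)
    where
    eq′ = trans (sym (+-suc m j)) eq
    m<m′ : m < m′
    m<m′ = subst (m <_) eq (m<m+n m (s≤s z≤n))
    far′ : e < m ⊎ m′ ≤ e → e < suc m ⊎ m′ ≤ e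
    far′ (inj₁ e<m)  = inj₁ (m<n⇒m<1+n e<m)
    far′ (inj₂ m′≤e) = inj₂ m′≤e
    e≢m : e < m ⊎ m′ ≤ e → e ≢ m
    e≢m (inj₁ e<m)  = <⇒≢ e<m
    e≢m (inj₂ m′≤e) = ≢-sym (<⇒≢ (<-≤-trans m<m′ m′≤e))

  -- Positions up to `d` lie in `x`; for `e` beyond `d`, `x∖N-before` supplies an element of
  -- `x ∖ N e` before `e`.
  ¬leading-own : ∀ {e} → e < k → ¬ Leading e e
  ¬leading-own {e} e<k ((_ , xe) , none) with d <? e
  ... | no d≮e = false≢true xe (x-initial (≮⇒≥ d≮e))
  ... | yes d<e with j , refl ← m≤n⇒∃[o]m+o≡n d<e
                with p , p<e , hp ← x∖N-before j (<⇒≤ e<k) = none p<e hp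

  wrap-∖ : ∀ {p} → ((N n ∖ x) p → (N 0 ∖ x) p) × ((x ∖ N 0) p → (x ∖ N n) p)
  wrap-∖ {p} rewrite wrap p = (λ h → h) , (λ h → h)

  ¬leading : ∀ {e m} → e < k → m ≤ n → ¬ Leading e m
  ¬leading {e} {m} e<k m≤n h with m ≤? e
  ... | yes m≤e = ¬leading-own e<k
          (leading-iterate (e ∸ m) e<k (m+[n∸m]≡n m≤e) (≤-trans (<⇒≤ e<k) k≤n) (inj₂ ≤-refl) h)
  -- Time `e` has already passed: run on to `n`, identify `N n` with `N 0`, and continue up to `e`.
  ... | no m≰e with (he , none) ← leading-iterate (n ∸ m) e<k (m+[n∸m]≡n m≤n) ≤-refl (inj₁ (≰⇒> m≰e)) h =
    ¬leading-own e<k (leading-iterate e e<k refl (≤-trans (<⇒≤ e<k) k≤n) (inj₂ ≤-refl)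
      (proj₁ wrap-∖ he , λ p<e hp → none p<e (proj₂ wrap-∖ hp)))

  -- Dually, persists backwards from time m to time e + 1.
  Trailing : ℕ → ℕ → Set
  Trailing e m = (x ∖ N m) e × (∀ {p} → e < p → p < n → ¬ (N m ∖ x) p)

  trailing-step : ∀ {e m} → k ≤ e → e < n → m < n → e ≢ m → Trailing e (suc m) → Trailing e m
  trailing-step {e} {m} k≤e e<n m<n e≢m (he , none) = he′ , none′
    where
    m≤n = <⇒≤ m<n
    he′ = x∖N-back m<n e<n e≢m he
    none′ : ∀ {p} → e < p → p < n → ¬ (N m ∖ x) p
    none′ {p} e<p p<n hp with p ≟ m
    ... | no p≢m = none e<p p<n (N∖x-forth m<n p<n p≢m hp)
    ... | yes refl
      with z , i , hz , z≢m ← count-<⇒∃-avoiding m (sparse m≤n) (right k≤e e<n) he′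
         | u , u<k , hu ← minus-left m≤n
      with <-cmp z e
    ... | tri> _ _ e<z = none e<z (right< i) (N∖x-forth m<n (right< i) z≢m hz)
    ... | tri≈ _ refl _ = false≢true (proj₂ he′) (proj₁ hz)
    ... | tri< z<e _ _ = uncrossed m≤n (<-≤-trans u<k (lower i)) z<e e<p p<n hu hz he′ hp

  trailing-iterate : ∀ {e} j {m m′} → k ≤ e → e < n → m + j ≡ m′ → m′ ≤ n → (e < m ⊎ m′ ≤ e) →
                     Trailing e m′ → Trailing e m
  trailing-iterate zero    {m} _ _ refl _ _ h = subst (Trailing _) (+-identityʳ m) h
  trailing-iterate {e} (suc j) {m} {m′} k≤e e<n eq m′≤n far h =
    trailing-step k≤e e<n (<-≤-trans m<m′ m′≤n) (e≢m far)
      (trailing-iterate j k≤e e<n eq′ m′≤n (far′ far) h)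
    where
    eq′ = trans (sym (+-suc m j)) eq
    m<m′ : m < m′
    m<m′ = subst (m <_) eq (m<m+n m (s≤s z≤n))
    far′ : e < m ⊎ m′ ≤ e → e < suc m ⊎ m′ ≤ e
    far′ (inj₁ e<m)  = inj₁ (m<n⇒m<1+n e<m)
    far′ (inj₂ m′≤e) = inj₂ m′≤e
    e≢m : e < m ⊎ m′ ≤ e → e ≢ m
    e≢m (inj₁ e<m)  = <⇒≢ e<m
    e≢m (inj₂ m′≤e) = ≢-sym (<⇒≢ (<-≤-trans m<m′ m′≤e))

  -- The last position is not in `x`; before it, `N∖x-after` at time `e + 1` supplies a later
  -- element of `N (suc e) ∖ x`.
  ¬trailing-left : ∀ {e} → k ≤ e → e < n → ¬ Trailing e (suc e)
  ¬trailing-left {e} k≤e e<n ((xe , _) , none) with m≤n⇒∃[o]m+o≡n e<n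
  ... | zero  , eq = false≢true (x-last (trans (sym (+-identityʳ (suc e))) eq)) xe
  ... | suc j , eq with p , e<p , p<n , hp ← N∖x-after j eq (m≤n⇒m≤1+n k≤e) = none e<p p<n hp

  ¬trailing : ∀ {e m} → k ≤ e → e < n → m ≤ n → ¬ Trailing e m
  ¬trailing {e} {m} k≤e e<n m≤n h with e <? m
  ... | yes e<m = ¬trailing-left k≤e e<n
          (trailing-iterate (m ∸ suc e) k≤e e<n (m+[n∸m]≡n e<m) m≤n (inj₁ ≤-refl) h)
  ... | no e≮m with (he , none) ← trailing-iterate m k≤e e<n refl m≤n (inj₂ (≮⇒≥ e≮m)) h =
    ¬trailing-left k≤e e<n (trailing-iterate (n ∸ suc e) k≤e e<n (m+[n∸m]≡n e<n) ≤-refl (inj₁ ≤-refl)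
      (proj₂ wrap-∖ he , λ e<p p<n hp → none e<p p<n (proj₁ wrap-∖ hp)))

  -- Such a `p` would be leading: an element `r` of `x ∖ N m` before it would cross with `p`, `q`
  -- and some `w` right of `k`.
  left-sorted : ∀ {m p q} → m ≤ n → p < q → q < k → (N m ∖ x) p → ¬ (x ∖ N m) q
  left-sorted m≤n p<q q<k hp hq with w , k≤w , w<n , hw ← plus-right m≤n =
    ¬leading (<-trans p<q q<k) m≤n
      (hp , λ r<p hr → uncrossed m≤n r<p p<q (<-≤-trans q<k k≤w) w<n hr hp hq hw)

  right-sorted : ∀ {m p q} → m ≤ n → k ≤ p → p < q → q < n → (N m ∖ x) p → ¬ (x ∖ N m) q
  right-sorted m≤n k≤p p<q q<n hp hq with u , u<k , hu ← minus-left m≤n =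
    ¬trailing (≤-trans k≤p (<⇒≤ p<q)) q<n m≤n
      (hq , λ q<r r<n hr → uncrossed m≤n (<-≤-trans u<k k≤p) p<q q<r r<n hu hp hq hr)

  sorted : ∀ {m p q} → m ≤ n → p < q → q < n → (N m ∖ x) p → ¬ (x ∖ N m) q
  sorted {m} {p} {q} m≤n p<q q<n hp hq with q <? k | k ≤? p
  ... | yes q<k | _       = left-sorted m≤n p<q q<k hp hq
  ... | no _    | yes k≤p = right-sorted m≤n k≤p p<q q<n hp hq
  -- Here `p < k ≤ q`. With `u` on the left and `w` on the right, either one of the two blocks is
  -- already out of order, or `u < p < q < w` is a crossing.
  ... | no q≮k  | no k≰p
    with u , u<k , hu ← minus-left m≤n | w , k≤w , w<n , hw ← plus-right m≤n
    with <-cmp u p | <-cmp w q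
  ... | tri> _ _ p<u  | _             = left-sorted m≤n p<u u<k hp hu
  ... | tri≈ _ refl _ | _             = false≢true (proj₂ hp) (proj₁ hu)
  ... | tri< _ _ _    | tri< w<q _ _  = right-sorted m≤n k≤w w<q q<n hw hq
  ... | tri< _ _ _    | tri≈ _ refl _ = false≢true (proj₂ hw) (proj₁ hq)
  ... | tri< u<p _ _  | tri> _ _ q<w  = uncrossed m≤n u<p p<q q<w w<n hu hp hq hw

-- Cyclic order and lifts to ℕ

<[]-asym : ∀ {n} {x y i : Fin n} → x <[ i ] y → ¬ y <[ i ] x
<[]-asym (first _ x<y)    (first _ y<x)    = <-asym x<y y<x
<[]-asym (first i≤x _)    (second _ x<i)   = <⇒≱ x<i i≤x
<[]-asym (first i≤x _)    (across _ x<i)   = <⇒≱ x<i i≤x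
<[]-asym (second x<y y<i) (first i≤y _)    = <⇒≱ y<i i≤y
<[]-asym (second x<y _)   (second y<x _)   = <-asym x<y y<x
<[]-asym (second x<y y<i) (across i≤y _)   = <⇒≱ y<i i≤y
<[]-asym (across i≤x y<i) (first i≤y _)    = <⇒≱ y<i i≤y
<[]-asym (across i≤x y<i) (second _ x<i)   = <⇒≱ x<i i≤x
<[]-asym (across i≤x y<i) (across i≤y _)   = <⇒≱ y<i i≤y

∈─⇒∈ : ∀ {n} {x : Fin n} (p q : Subset n) → x ∈ p ─ q → x ∈ p × x ∉ q
∈─⇒∈ (_ ∷ p) (outside ∷ q) here = here , λ ()
∈─⇒∈ (_ ∷ p) (_ ∷ q) (there x∈) with x∈p , x∉q ← ∈─⇒∈ p q x∈ = there x∈p , λ { (there x∈q) → x∉q x∈q }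

count-lookup : ∀ {l} (Z : Subset l) (f : ℕ → Bool) a → (∀ i → f (a + toℕ i) ≡ lookup Z i) →
               count f a l ≡ ∣ Z ∣
count-lookup []      f a h = refl
count-lookup (b ∷ Z) f a h with f a | trans (cong f (sym (+-identityʳ a))) (h zero)
                              | count-lookup Z f (suc a) (λ i → trans (cong f (sym (+-suc a (toℕ i)))) (h (suc i)))
... | true  | refl | rest = cong suc rest
... | false | refl | rest = rest

module _ {n : ℕ} .{{_ : NonZero n}} where

  toℕ-mod : ∀ p → toℕ (p mod n) ≡ p % n
  toℕ-mod p = toℕ-fromℕ< (m%n<n p n)

  %⇒mod : ∀ {p q} → p % n ≡ q % n → p mod n ≡ q mod n
  %⇒mod {p} {q} h = toℕ-injective (trans (toℕ-mod p) (trans h (sym (toℕ-mod q))))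

  mod-toℕ : ∀ (i : Fin n) → toℕ i mod n ≡ i
  mod-toℕ i = toℕ-injective (trans (toℕ-mod (toℕ i)) (m<n⇒m%n≡m (toℕ<n i)))

  mod-+n : ∀ p → (p + n) mod n ≡ p mod n
  mod-+n p = %⇒mod ([m+n]%n≡m%n p n)

  next-mod : ∀ m → next (m mod n) ≡ suc m mod n
  next-mod m = %⇒mod (begin
    suc (toℕ (m mod n)) % n                ≡⟨ cong (λ k → suc k % n) (toℕ-mod m) ⟩
    suc (m % n) % n                        ≡⟨ [m+kn]%n≡m%n (suc (m % n)) (m / n) n ⟨
    suc (m % n + m / n * n) % n            ≡⟨ cong (λ k → suc k % n) (m≡m%n+[m/n]*n m n) ⟨
    suc m % n                              ∎)
    where open ≡-Reasoning

  lift : ∀ a (i : Fin n) → ∃ λ p → a ≤ p × p < a + n × p mod n ≡ i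
  lift zero    i = toℕ i , z≤n , toℕ<n i , mod-toℕ i
  lift (suc a) i with p , a≤p , p<a+n , eq ← lift a i with m≤n⇒m<n∨m≡n a≤p
  ... | inj₁ a<p  = p , a<p , m<n⇒m<1+n p<a+n , eq
  ... | inj₂ refl = a + n , m<m+n a (>-nonZero⁻¹ n) , n<1+n (a + n) , trans (mod-+n a) eq

  toℕ-mod-< : ∀ {p} → p < n → toℕ (p mod n) ≡ p
  toℕ-mod-< {p} p<n = trans (toℕ-mod p) (m<n⇒m%n≡m p<n)

  <[]-mod₀ : ∀ {s p q} → s < n → s ≤ p → p < q → q < s + n → (p mod n) <[ s mod n ] (q mod n)
  <[]-mod₀ {s} {p} {q} s<n s≤p p<q q<s+n = cases (p <? n) (q <? n)
    where
    wrapped : ∀ {p} → n ≤ p → p < s + n → ∃ λ p′ → p′ < s × p ≡ p′ + n × toℕ (p mod n) ≡ p′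
    wrapped {p} n≤p p<s+n = p ∸ n , p′<s , sym (m∸n+n≡m n≤p) ,
      trans (cong (λ k → toℕ (k mod n)) (sym (m∸n+n≡m n≤p)))
            (trans (cong toℕ (mod-+n (p ∸ n))) (toℕ-mod-< (<-trans p′<s s<n)))
      where p′<s = +-cancelʳ-< n (p ∸ n) s (subst (_< s + n) (sym (m∸n+n≡m n≤p)) p<s+n)
    s≡ = toℕ-mod-< s<n
    cases : Dec (p < n) → Dec (q < n) → (p mod n) <[ s mod n ] (q mod n)
    cases (yes p<n) (yes q<n) =
      first (subst₂ _≤_ (sym s≡) (sym (toℕ-mod-< p<n)) s≤p)
            (subst₂ _<_ (sym (toℕ-mod-< p<n)) (sym (toℕ-mod-< q<n)) p<q)
    cases (yes p<n) (no q≮n) with q′ , q′<s , _ , q≡ ← wrapped (≮⇒≥ q≮n) q<s+n =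
      across (subst₂ _≤_ (sym s≡) (sym (toℕ-mod-< p<n)) s≤p) (subst₂ _<_ (sym q≡) (sym s≡) q′<s)
    cases (no p≮n) _ with p′ , _ , p≡p′+n , p≡ ← wrapped (≮⇒≥ p≮n) (<-trans p<q q<s+n)
                        | q′ , q′<s , q≡q′+n , q≡ ← wrapped (≤-trans (≮⇒≥ p≮n) (<⇒≤ p<q)) q<s+n =
      second (subst₂ _<_ (sym p≡) (sym q≡) (+-cancelʳ-< n p′ q′ (subst₂ _<_ p≡p′+n q≡q′+n p<q)))
             (subst₂ _<_ (sym q≡) (sym s≡) q′<s)

  <[]-mod : ∀ {s p q} → s ≤ p → p < q → q < s + n → (p mod n) <[ s mod n ] (q mod n)
  <[]-mod {s} {p} {q} s≤p p<q q<s+n =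
    subst₂ (λ i j → i <[ s mod n ] j) (reduce c≤p) (reduce c≤q)
      (subst (λ i → ((p ∸ c) mod n) <[ i ] ((q ∸ c) mod n)) (%⇒mod (m%n%n≡m%n s n))
        (<[]-mod₀ (m%n<n s n)
          (+-cancelʳ-≤ c (s % n) (p ∸ c) (subst₂ _≤_ s≡ (sym (m∸n+n≡m c≤p)) s≤p))
          (∸-monoˡ-< p<q c≤p)
          (+-cancelʳ-< c (q ∸ c) (s % n + n)
            (subst₂ _<_ (sym (m∸n+n≡m c≤q)) s+n≡ q<s+n))))
    where
    -- Translating by this multiple of `n` brings the start of the window below `n`, where
    -- `<[]-mod₀` applies.
    c = s / n * n
    s≡ = m≡m%n+[m/n]*n s n
    s+n≡ : s + n ≡ s % n + n + c
    s+n≡ = begin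
      s + n              ≡⟨ cong (_+ n) s≡ ⟩
      s % n + c + n      ≡⟨ +-assoc (s % n) c n ⟩
      s % n + (c + n)    ≡⟨ cong (s % n +_) (+-comm c n) ⟩
      s % n + (n + c)    ≡⟨ +-assoc (s % n) n c ⟨
      s % n + n + c      ∎
      where open ≡-Reasoning
    c≤p = ≤-trans (m+n≤o⇒n≤o (s % n) (≤-reflexive (sym s≡))) s≤p
    c≤q = ≤-trans c≤p (<⇒≤ p<q)
    reduce : ∀ {t} → c ≤ t → (t ∸ c) mod n ≡ t mod n
    reduce {t} c≤t = %⇒mod (trans (sym ([m+kn]%n≡m%n (t ∸ c) (s / n) n)) (cong (_% n) (m∸n+n≡m c≤t)))

  mod-injective : ∀ {p q} → p < q → q < p + n → p mod n ≢ q mod n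
  mod-injective {p} {q} p<q q<p+n eq =
    <[]-asym lt (subst₂ (λ i j → i <[ p mod n ] j) eq (sym eq) lt)
    where lt = <[]-mod ≤-refl p<q q<p+n

  -- Subsets of the cycle as periodic sequences on ℕ.

  _‼_ : Subset n → ℕ → Bool
  Z ‼ p = lookup Z (p mod n)

  _⊖_ : Subset n → Subset n → ℕ → Set
  X ⊖ Z = (X ‼_) ∖ (Z ‼_)

  infix 8 _‼_
  infixl 6 _⊖_

  ‼-+n : ∀ Z p → Z ‼ (p + n) ≡ Z ‼ p
  ‼-+n Z p = cong (lookup Z) (mod-+n p)

  ⊖-+n : ∀ X Z {p} → (X ⊖ Z) p → (X ⊖ Z) (p + n)
  ⊖-+n X Z {p} (xp , zp) = trans (‼-+n X p) xp , trans (‼-+n Z p) zp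

  count-+n : ∀ Z a l → count (Z ‼_) (a + n) l ≡ count (Z ‼_) a l
  count-+n Z a zero    = refl
  count-+n Z a (suc l) = cong₂ (λ b c → bit b + c) (‼-+n Z a) (count-+n Z (suc a) l)

  -- Sliding the window by one drops `a` and takes in `a + n`, which carry the same bit.
  count-size : ∀ Z a → count (Z ‼_) a n ≡ ∣ Z ∣
  count-size Z zero    = count-lookup Z (Z ‼_) 0 (λ i → cong (lookup Z) (mod-toℕ i))
  count-size Z (suc a) = +-cancelˡ-≡ (bit (Z ‼ a)) _ _ (begin
    bit (Z ‼ a) + count (Z ‼_) (suc a) n       ≡⟨⟩
    count (Z ‼_) a (1 + n)                     ≡⟨ cong (count (Z ‼_) a) (+-comm 1 n) ⟩
    count (Z ‼_) a (n + 1)                     ≡⟨ count-++ (Z ‼_) a n 1 ⟩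
    count (Z ‼_) a n + (bit (Z ‼ (a + n)) + 0) ≡⟨ cong (count (Z ‼_) a n +_) (+-identityʳ _) ⟩
    count (Z ‼_) a n + bit (Z ‼ (a + n))       ≡⟨ cong₂ (λ c b → c + bit b) (count-size Z a) (‼-+n Z a) ⟩
    ∣ Z ∣ + bit (Z ‼ a)                        ≡⟨ +-comm ∣ Z ∣ _ ⟩
    bit (Z ‼ a) + ∣ Z ∣                        ∎)
    where open ≡-Reasoning

  ∈⇒‼ : ∀ {Z : Subset n} {p i} → p mod n ≡ i → i ∈ Z → Z ‼ p ≡ true
  ∈⇒‼ refl i∈Z = []=⇒lookup i∈Z

  ‼⇒∈ : ∀ (Z : Subset n) {p} → Z ‼ p ≡ true → p mod n ∈ Z
  ‼⇒∈ Z {p} h = lookup⇒[]= (p mod n) Z h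

  ⊖⇒∈─ : ∀ (X Z : Subset n) {p} → (X ⊖ Z) p → p mod n ∈ X ─ Z
  ⊖⇒∈─ X Z (xp , zp) = x∈p∧x∉q⇒x∈p─q (‼⇒∈ X xp) (λ ∈Z → false≢true zp ([]=⇒lookup ∈Z))

  ∈─⇒⊖ : ∀ (X Z : Subset n) {p i} → p mod n ≡ i → i ∈ X ─ Z → (X ⊖ Z) p
  ∈─⇒⊖ X Z refl i∈ with i∈X , i∉Z ← ∈─⇒∈ X Z i∈ =
    []=⇒lookup i∈X , ≢true⇒false λ h → i∉Z (‼⇒∈ Z h)

  ≪⇒sorted : ∀ {X Z s p q} → X ≪[ s mod n ] Z → s ≤ p → p < q → q < s + n →
             (Z ⊖ X) p → ¬ (X ⊖ Z) q
  ≪⇒sorted {X} {Z} X≪Z s≤p p<q q<s+n hp hq =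
    <[]-asym (<[]-mod s≤p p<q q<s+n) (X≪Z _ _ (⊖⇒∈─ X Z hq) (⊖⇒∈─ Z X hp))

  sorted⇒≪ : ∀ {X Z} s → (∀ {p q} → s ≤ p → p < q → q < s + n → (Z ⊖ X) p → ¬ (X ⊖ Z) q) →
             X ≪[ s mod n ] Z
  sorted⇒≪ {X} {Z} s sorted i j i∈ j∈
    with p , s≤p , p<s+n , p≡ ← lift s i | q , s≤q , q<s+n , q≡ ← lift s j
    with hp ← ∈─⇒⊖ X Z p≡ i∈ | hq ← ∈─⇒⊖ Z X q≡ j∈
    with <-cmp p q
  ... | tri< p<q _ _  = subst₂ (λ i j → i <[ s mod n ] j) p≡ q≡ (<[]-mod s≤p p<q q<s+n)
  ... | tri≈ _ refl _ = ⊥-elim (false≢true (proj₂ hp) (proj₁ hq))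
  ... | tri> _ _ q<p  = ⊥-elim (sorted s≤q q<p p<s+n hq hp)

  -- Wherever the cut `s` falls in `[p, p + n)`, one pair stays in the wrong order after it: `q` and
  -- `r`, or `t` and `p + n`, or `q + n` and `r + n`.
  ∥⇒uncrossed : ∀ {X Z p q r t} → X ∥ Z → p < q → q < r → r < t → t < p + n →
                (X ⊖ Z) p → (Z ⊖ X) q → (X ⊖ Z) r → ¬ (Z ⊖ X) t
  ∥⇒uncrossed {X} {Z} {p} {q} {r} {t} (j , X≪Z) p<q q<r r<t t<p+n hp hq hr ht
    with s , p≤s , s<p+n , refl ← lift p j
    with s ≤? q | s ≤? t
  ... | yes s≤q | _       = ≪⇒sorted {X} {Z} X≪Z s≤q q<r
          (<-≤-trans (<-trans r<t t<p+n) (+-monoˡ-≤ n p≤s)) hq hr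
  ... | no s≰q  | yes s≤t = ≪⇒sorted {X} {Z} X≪Z s≤t t<p+n
          (+-monoˡ-< n (<-trans p<q (≰⇒> s≰q))) ht (⊖-+n X Z hp)
  ... | no s≰q  | no s≰t  = ≪⇒sorted {X} {Z} X≪Z
          (<⇒≤ (<-trans s<p+n (+-monoˡ-< n p<q))) (+-monoˡ-< n q<r)
          (+-monoˡ-< n (<-trans r<t (≰⇒> s≰t))) (⊖-+n Z X hq) (⊖-+n X Z hr)

-- Necklaces

true-or-false : ∀ b → b ≡ true ⊎ b ≡ false
true-or-false true  = inj₁ refl
true-or-false false = inj₂ refl

-- Searches from the right end; `d` is the length of the run of true values that follows `q`.
last-false : ∀ (f : ℕ → Bool) a l {p} → InRange a l p → f p ≡ false →
             ∃ λ q → ∃ λ d → a ≤ q × suc q + d ≡ a + l × f q ≡ false ×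
                             (∀ {t} → q < t → t < a + l → f t ≡ true)
last-false f a (suc l) {p} i fp rewrite +-suc a l with true-or-false (f (a + l))
... | inj₂ f≡ = a + l , 0 , m≤m+n a l , +-identityʳ _ , f≡ ,
  λ a+l<t t<1+a+l → ⊥-elim (<⇒≱ t<1+a+l a+l<t)
... | inj₁ t≡ with m≤n⇒m<n∨m≡n (s≤s⁻¹ (≤-trans (upper i) (≤-reflexive (+-suc a l))))
...   | inj₂ refl = ⊥-elim (false≢true fp t≡)
...   | inj₁ p<a+l with q , d , a≤q , eq , fq , h ← last-false f a l (inRange (lower i) p<a+l) fp =
  q , suc d , a≤q , trans (+-suc (suc q) d) (cong suc eq) , fq , all
  where
  all : ∀ {t} → q < t → t < suc (a + l) → f t ≡ true
  all q<t t<1+a+l with m≤n⇒m<n∨m≡n (s≤s⁻¹ t<1+a+l)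
  ... | inj₁ t<a+l = h q<t t<a+l
  ... | inj₂ refl  = t≡

count-complement-≤ : ∀ f g a k l → count f a (k + l) ≡ count g a (k + l) →
                     count f a k ≤ count g a k → count g (a + k) l ≤ count f (a + k) l
count-complement-≤ f g a k l eq le = ≮⇒≥ λ lt →
  <⇒≢ (+-mono-≤-< le lt) (trans (sym (count-++ f a k l)) (trans eq (count-++ g a k l)))

count-complement-< : ∀ f g a k l → count f a (k + l) ≡ count g a (k + l) →
                     count f a k < count g a k → count g (a + k) l < count f (a + k) l
count-complement-< f g a k l eq lt = ≰⇒> λ le →
  <⇒≢ (+-mono-<-≤ lt le) (trans (sym (count-++ f a k l)) (trans eq (count-++ g a k l)))

module _ {n r : ℕ} .{{_ : NonZero n}} (N : Necklace n r) (own : ∀ i → i ∈ set N i) where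

  time : ℕ → Subset n
  time m = set N (m mod n)

  time-+n : ∀ m → time (m + n) ≡ time m
  time-+n m = cong (set N) (mod-+n m)

  time-own : ∀ m → time m ‼ m ≡ true
  time-own m = ∈⇒‼ refl (own (m mod n))

  count-layer : ∀ Z a i → Layer r Z → count (Z ‼_) a n ≡ count (set N i ‼_) a n
  count-layer Z a i size = trans (trans (count-size Z a) size)
                                   (sym (trans (count-size (set N i) a) (layer N i)))

  time-exchange : ∀ {m p} → p mod n ≢ m mod n → time m ‼ p ≡ true → time (suc m) ‼ p ≡ true
  time-exchange {m} {p} p≢m h = ∈⇒‼ refl (subst (λ i → p mod n ∈ set N i) (next-mod m)
    (exchange N (m mod n) (x∈p∧x≢y⇒x∈p-y (‼⇒∈ (time m) h) p≢m)))

  ⊖-resp-mod : ∀ (X Z : Subset n) {p q} → p mod n ≡ q mod n → (X ⊖ Z) p → (X ⊖ Z) q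
  ⊖-resp-mod X Z eq (xp , zp) = trans (cong (lookup X) (sym eq)) xp , trans (cong (lookup Z) (sym eq)) zp

  -- Equal sizes force a loss to match the gain, and the exchange condition lets only `m` be lost.
  gain⇒loss : ∀ {m p} → (time (suc m) ⊖ time m) p → time (suc m) ‼ m ≡ false
  gain⇒loss {m} {p} gain
    with p′ , m≤p′ , p′<m+n , p′≡p ← lift m (p mod n)
    with z , i , nz , nz′ ← count-≤⇒∃ (≤-reflexive (count-layer (time (suc m)) m (m mod n) (layer N (suc m mod n))))
                              (inRange m≤p′ p′<m+n)
                              (⊖-resp-mod (time (suc m)) (time m) (sym p′≡p) gain)
    with z mod n Fin.≟ m mod n
  ... | yes z≡m = trans (cong (lookup (time (suc m))) (sym z≡m)) nz′
  ... | no  z≢m = ⊥-elim (false≢true nz′ (time-exchange z≢m nz))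

  time-stay : ∀ {m} p → time (suc m) ‼ m ≡ true → time (suc m) ‼ p ≡ time m ‼ p
  time-stay {m} p fixed with true-or-false (time m ‼ p)
  ... | inj₂ np = trans (≢true⇒false λ np′ → false≢true (gain⇒loss (np′ , np)) fixed) (sym np)
  ... | inj₁ np with p mod n Fin.≟ m mod n
  ...   | yes p≡m = trans (trans (cong (lookup (time (suc m))) p≡m) fixed) (sym np)
  ...   | no p≢m  = trans (time-exchange p≢m np) (sym np)

  -- Two distinct gains would need two losses, one of them at a position other than `m`.
  gain-unique : ∀ {m p q} → (time (suc m) ⊖ time m) p → (time (suc m) ⊖ time m) q →
                p mod n ≡ q mod n
  gain-unique {m} {p} {q} hp hq
    with p′ , m≤p′ , p′<m+n , p′≡p ← lift m (p mod n) | q′ , m≤q′ , q′<m+n , q′≡q ← lift m (q mod n)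
    with p′ ≟ q′
  ... | yes refl = trans (sym p′≡p) q′≡q
  ... | no p′≢q′
    with hp′ ← ⊖-resp-mod (time (suc m)) (time m) (sym p′≡p) hp
       | hq′ ← ⊖-resp-mod (time (suc m)) (time m) (sym q′≡q) hq
    with z , i , (nz , rz) , z≢m ← count-<⇒∃-avoiding {f = remove p′ (time (suc m) ‼_)} m
           (<-≤-trans (count-remove-< (inRange m≤p′ p′<m+n) (proj₁ hp′))
                      (≤-reflexive (count-layer (time (suc m)) m (m mod n) (layer N (suc m mod n)))))
           (inRange m≤q′ q′<m+n)
           (trans (remove-other p′ (time (suc m) ‼_) (≢-sym p′≢q′)) (proj₁ hq′) , proj₂ hq′)
    = ⊥-elim (false≢true rz
          (trans (remove-other p′ (time (suc m) ‼_) λ { refl → false≢true (proj₂ hp′) nz })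
                 (time-exchange (≢-sym (mod-injective (≤∧≢⇒< (lower i) (≢-sym z≢m)) (upper i))) nz)))

  -- Counts on cyclic intervals along the necklace.

  rank-inside : ∀ {a l m} → l ≤ n → InRange a l m →
                count (time (suc m) ‼_) a l ≤ count (time m ‼_) a l
  -- An increase means a gain `y` in the interval, hence the loss of `m`, which lies there too; a
  -- net increase then needs a second gain.
  rank-inside {a} {l} {m} l≤n i = ≮⇒≥ λ lt →
    let y , j , gy       = count-<⇒∃ a l lt
        z , k , gz , z≢y = count-<⇒∃-avoiding y lt i (time-own m , gain⇒loss gy)
    in z≢y (same k j (gain-unique gz gy))
    where
    near : ∀ {p q} → InRange a l p → InRange a l q → p < q + n
    near i j = <-≤-trans (upper i) (+-mono-≤ (lower j) l≤n)
    same : ∀ {p q} → InRange a l p → InRange a l q → p mod n ≡ q mod n → p ≡ q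
    same {p} {q} i j eq with <-cmp p q
    ... | tri< p<q _ _ = ⊥-elim (mod-injective p<q (near j i) eq)
    ... | tri≈ _ p≡q _ = p≡q
    ... | tri> _ _ q<p = ⊥-elim (mod-injective q<p (near i j) (sym eq))

  rank-outside : ∀ {a l m} → a + l ≤ m → m < a + n →
                 count (time m ‼_) a l ≤ count (time (suc m) ‼_) a l
  rank-outside {a} {l} a+l≤m m<a+n = count-mono a l λ i →
    time-exchange (mod-injective (<-≤-trans (upper i) a+l≤m) (<-≤-trans m<a+n (+-monoˡ-≤ n (lower i))))

  rank-descends : ∀ {a l} j → l ≤ n → j ≤ l → count (time (a + j) ‼_) a l ≤ count (time a ‼_) a l
  rank-descends {a} zero    l≤n _   rewrite +-identityʳ a = ≤-refl
  rank-descends {a} (suc j) l≤n j<l rewrite +-suc a j =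
    ≤-trans (rank-inside l≤n (inRange (m≤m+n a j) (+-monoʳ-< a j<l))) (rank-descends j l≤n (<⇒≤ j<l))

  rank-ascends : ∀ {a l m} j → a + l ≤ m → m + j ≡ a + n →
                 count (time m ‼_) a l ≤ count (time a ‼_) a l
  rank-ascends {a} {l} {m} zero    a+l≤m eq =
    ≤-reflexive (cong (λ Z → count (Z ‼_) a l)
      (trans (cong time (trans (sym (+-identityʳ m)) eq)) (time-+n a)))
  rank-ascends {a} {l} {m} (suc j) a+l≤m eq =
    ≤-trans (rank-outside a+l≤m (subst (m <_) eq (m<m+n m (s≤s z≤n))))
            (rank-ascends j (m≤n⇒m≤1+n a+l≤m) (trans (sym (+-suc m j)) eq))

  -- From time `a` on, the count descends while the time runs through the interval and ascends
  -- afterwards until `a + n`, so the maximum over the cycle is at `a`.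
  rank-max : ∀ a l → l ≤ n → ∀ i → count (set N i ‼_) a l ≤ count (time a ‼_) a l
  rank-max a l l≤n i with m , a≤m , m<a+n , refl ← lift a i with m ≤? a + l
  ... | yes m≤a+l with j , refl ← m≤n⇒∃[o]m+o≡n a≤m = rank-descends j l≤n (+-cancelˡ-≤ a j l m≤a+l)
  ... | no m≰a+l with j , eq ← m≤n⇒∃[o]m+o≡n (<⇒≤ m<a+n) = rank-ascends j (<⇒≤ (≰⇒> m≰a+l)) eq

  -- Only the step from time `a` can drop `a`; surviving it, `a` survives the whole turn.
  fixed-everywhere : ∀ {a} → time (suc a) ‼ a ≡ true → ∀ i → set N i ‼ a ≡ true
  fixed-everywhere {a} fixed i with m , a<m , m≤a+n , refl ← lift (suc a) i
                               with j , refl ← m≤n⇒∃[o]m+o≡n a<m = go j (s≤s⁻¹ m≤a+n)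
    where
    go : ∀ j → suc a + j ≤ a + n → time (suc a + j) ‼ a ≡ true
    go zero    _  rewrite +-identityʳ a = fixed
    go (suc j) le rewrite +-suc a j =
      time-exchange (mod-injective (s≤s (m≤m+n a j)) le) (go j (<⇒≤ le))

  -- A common cut for a set in the exterior.

  module _ {X : Subset n} (size : Layer r X) (separated : ∀ i → X ∥ set N i) where

    Overfull : ℕ → ℕ → Set
    Overfull a l = ∀ i → count (set N i ‼_) a l < count (X ‼_) a l

    overfull : ¬ (∀ i → set N i ≪[ i ] X) → ∃ λ a → ∃ λ l → l ≤ n × Overfull a l
    -- By `rank-max` it suffices to compare `X` with `time a` on the intervals starting at `a`, a
    -- finite search.
    overfull ¬≪ with anyUpTo? (λ a → anyUpTo? (λ l → count (time a ‼_) a l <? count (X ‼_) a l) (suc n)) n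
    ... | yes (a , _ , l , l≤n , lt) = a , l , s≤s⁻¹ l≤n , λ i → ≤-<-trans (rank-max a l (s≤s⁻¹ l≤n) i) lt
    ... | no none = ⊥-elim (¬≪ λ i → subst (λ j → set N j ≪[ j ] X) (mod-toℕ i)
                      (sorted⇒≪ {X = time (toℕ i)} {Z = X} (toℕ i) (ordered (toℕ<n i))))
      where
      ballot : ∀ {a l} → a < n → l ≤ n → count (X ‼_) a l ≤ count (time a ‼_) a l
      ballot a<n l≤n = ≮⇒≥ λ lt → none (_ , a<n , _ , s≤s l≤n , lt)
      ordered : ∀ {a p q} → a < n → a ≤ p → p < q → q < a + n → (X ⊖ time a) p → ¬ (time a ⊖ X) q
      ordered {a} {p} {q} a<n a≤p p<q q<a+n hp hq
        with j , refl ← m≤n⇒∃[o]m+o≡n a≤p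
        with k , refl ← m≤n⇒∃[o]m+o≡n (≤-trans a≤p (<⇒≤ p<q))
        with k<n ← +-cancelˡ-< a k n q<a+n
        with l , refl ← m≤n⇒∃[o]m+o≡n (<⇒≤ k<n)
        -- The bound on `[a, p]` gives `y` in `time a ⊖ X` before `p`; the complementary bound on
        -- `[q, a + n)` gives `z` in `X ⊖ time a` after `q`. Then `p`, `q`, `z`, `y + n` cross.
        with y , iy , hy ← count-≤⇒∃ (ballot {l = suc j} a<n (<-trans (+-cancelˡ-< a j k p<q) k<n))
                             (inRange a≤p (+-monoʳ-< a (n<1+n j))) hp
           | z , iz , hz ← count-≤⇒∃
               (count-complement-≤ (X ‼_) (time a ‼_) a k l
                 (count-layer X a (a mod n) size) (ballot a<n (<⇒≤ k<n)))
               (inRange ≤-refl (subst (a + k <_) (sym (+-assoc a k l)) q<a+n)) hq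
        = ∥⇒uncrossed {X = X} {Z = time a} (separated (a mod n)) p<q
            (≤∧≢⇒< (lower iz) λ { refl → false≢true (proj₂ hq) (proj₁ hz) })
            (<-≤-trans (<-≤-trans (upper iz) (≤-reflexive (+-assoc a k l))) (+-monoˡ-≤ n (lower iy)))
            (+-monoˡ-< n (≤∧≢⇒< (s≤s⁻¹ (<-≤-trans (upper iy) (≤-reflexive (+-suc a j))))
              λ { refl → false≢true (proj₂ hp) (proj₁ hy) }))
            hp hq hz (⊖-+n (time a) X hy)

    -- A first position outside `X` can be cut off without lowering the count of `X`; one in `X`
    -- that never leaves the necklace lowers every count by one. An empty interval is not overfull,
    -- so the process stops at a position of the wanted kind.
    overfull-shrink : ∀ l {a} → Overfull a l →
      ∃ λ b → ∃ λ k → k ≤ l × Overfull b k × (X ‼ b ≡ true) × (time (suc b) ‼ b ≡ false)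
    overfull-shrink zero    {a} over = ⊥-elim (n≮0 (over (a mod n)))
    overfull-shrink (suc l) {a} over with true-or-false (X ‼ a) | true-or-false (time (suc a) ‼ a)
    ... | inj₁ xa | inj₂ na = a , suc l , ≤-refl , over , xa , na
    ... | inj₂ xa | _ =
      let b , k , k≤l , rest = overfull-shrink l λ i →
            ≤-<-trans (m≤n+m _ (bit (set N i ‼ a)))
                      (subst (λ c → _ < bit c + count (X ‼_) (suc a) l) xa (over i))
      in b , k , m≤n⇒m≤1+n k≤l , rest
    ... | inj₁ xa | inj₁ na =
      let b , k , k≤l , rest = overfull-shrink l λ i →
            s≤s⁻¹ (subst₂ (λ b c → bit b + count (set N i ‼_) (suc a) l < bit c + count (X ‼_) (suc a) l)
                          (fixed-everywhere na i) xa (over i))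
      in b , k , m≤n⇒m≤1+n k≤l , rest

    -- Chooses the rotation for `Exterior`: the window starts just after the last non-element of `X`
    -- that precedes the next copy of the overfull interval.
    exterior-sorted-at : ∀ {a l} → l ≤ n → Overfull a l → X ‼ a ≡ true → time (suc a) ‼ a ≡ false →
                         ∃ λ s → ∀ i → X ≪[ s mod n ] set N i
    exterior-sorted-at {a} {l} l≤n over xa leaves
      with g , refl ← m≤n⇒∃[o]m+o≡n l≤n
      -- Sizes agree, so off the overfull interval `X` has fewer elements than `time a` and misses
      -- some position.
      with p , ip , _ , xp ← count-<⇒∃ (a + l) g
             (count-complement-< (time a ‼_) (X ‼_) a l g (sym (count-layer X a (a mod n) size)) (over (a mod n)))
      with q , d , a+l≤q , eq , xq , full ← last-false (X ‼_) (a + l) g ip xp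
      = s , λ i → sorted⇒≪ {X = X} {Z = set N i} s (sorted-at i)
      where
      s = suc q
      s+d≡a+n : s + d ≡ a + n
      s+d≡a+n = trans eq (+-assoc a l g)
      room : d + l < n
      room = +-cancelˡ-< a (d + l) n (begin-strict
        a + (d + l)    ≡⟨ cong (a +_) (+-comm d l) ⟩
        a + (l + d)    ≡⟨ +-assoc a l d ⟨
        a + l + d      <⟨ +-monoˡ-< d (s≤s a+l≤q) ⟩
        s + d          ≡⟨ s+d≡a+n ⟩
        a + n          ∎)
        where open ≤-Reasoning
      rest = n ∸ (d + l)
      rest≡ : d + l + rest ≡ n
      rest≡ = m+[n∸m]≡n (<⇒≤ room)
      x : ℕ → Bool
      x p = X ‼ (s + p)
      M : ℕ → ℕ → Bool
      M m p = time (s + m) ‼ (s + p)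
      count-tail : ∀ Z → count (Z ‼_) (s + d) l ≡ count (Z ‼_) a l
      count-tail Z = trans (cong (λ b → count (Z ‼_) b l) s+d≡a+n) (count-+n Z a l)
      -- The `d` positions put in front all belong to `X`, so the surplus of `X` is kept.
      over′ : Overfull s (d + l)
      over′ i = subst₂ _<_ (sym (count-++ (set N i ‼_) s d l)) (sym (count-++ (X ‼_) s d l))
        (+-mono-≤-< (count-mono s d λ j _ → full (lower j) (<-≤-trans (upper j) (≤-reflexive eq)))
                    (subst₂ _<_ (sym (count-tail (set N i))) (sym (count-tail X)) (over i)))
      dense : ∀ {m} → count (M m) 0 (d + l) < count x 0 (d + l)
      dense {m} = subst₂ _<_ (base (time (s + m))) (base X) (over′ ((s + m) mod n))
        where
        base : ∀ Z → count (Z ‼_) s (d + l) ≡ count (λ p → Z ‼ (s + p)) 0 (d + l)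
        base Z = sym (trans (count-shift (Z ‼_) s 0 (d + l))
                            (cong (λ b → count (Z ‼_) b (d + l)) (+-identityʳ s)))
      total : ∀ Z → count (λ p → Z ‼ (s + p)) 0 (d + l + rest) ≡ count (Z ‼_) (s + 0) n
      total Z = trans (count-shift (Z ‼_) s 0 (d + l + rest)) (cong (count (Z ‼_) (s + 0)) rest≡)
      sparse : ∀ {m} → count x (d + l) rest < count (M m) (d + l) rest
      sparse {m} = count-complement-< (M m) x 0 (d + l) rest
        (trans (total (time (s + m)))
               (trans (sym (count-layer X (s + 0) ((s + m) mod n) size)) (sym (total X))))
        (dense {m})
      distinct : ∀ {m p} → m < n → p < n → p ≢ m → (s + p) mod n ≢ (s + m) mod n
      distinct {m} {p} m<n p<n p≢m eq with <-cmp p m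
      ... | tri< p<m _ _ = mod-injective (+-monoʳ-< s p<m)
              (<-≤-trans (+-monoʳ-< s m<n) (+-monoˡ-≤ n (m≤m+n s p))) eq
      ... | tri≈ _ p≡m _ = p≢m p≡m
      ... | tri> _ _ m<p = mod-injective (+-monoʳ-< s m<p)
              (<-≤-trans (+-monoʳ-< s p<n) (+-monoˡ-≤ n (m≤m+n s m))) (sym eq)
      suc-time : ∀ m p → M (suc m) p ≡ time (suc (s + m)) ‼ (s + p)
      suc-time m p = cong (λ t → time t ‼ (s + p)) (+-suc s m)
      overfull-nonempty : d < d + l
      overfull-nonempty = m<m+n d (n≢0⇒n>0 λ { refl → n≮0 (over (a mod n)) })
      initial : ∀ {p} → p ≤ d → x p ≡ true
      initial {p} p≤d with m≤n⇒m<n∨m≡n p≤d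
      ... | inj₁ p<d  = full (m≤m+n s p) (<-≤-trans (+-monoʳ-< s p<d) (≤-reflexive eq))
      ... | inj₂ refl = trans (cong (X ‼_) s+d≡a+n) (trans (‼-+n X a) xa)
      -- Relative position `d` is `a + n`, a copy of `a`.
      d-leaves : M (suc d) d ≡ false
      d-leaves = trans (suc-time d d) (trans (cong (λ t → time (suc t) ‼ t) s+d≡a+n)
        (trans (‼-+n (time (suc a + n)) a) (trans (cong (_‼ a) (time-+n (suc a))) leaves)))
      -- The last relative position is `q + n`, a copy of the non-element `q`.
      final : ∀ {p} → suc p ≡ n → x p ≡ false
      final {p} 1+p≡n = trans (cong (X ‼_) (trans (sym (+-suc q p)) (cong (q +_) 1+p≡n)))
                              (trans (‼-+n X q) xq)
      module E = Exterior n x M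
        (λ {m} {p} m<n p<n p≢m h → trans (suc-time m p) (time-exchange (distinct m<n p<n p≢m) h))
        (λ {m} _ → time-own (s + m))
        (λ p → cong (_‼ (s + p)) (trans (time-+n s) (cong time (sym (+-identityʳ s)))))
        (λ {m} {p} _ _ h → trans (suc-time m p) (time-stay (s + p) (trans (sym (suc-time m m)) h)))
        (λ {m} {p} _ p<q q<r r<t t<n → ∥⇒uncrossed {X = X} {Z = time (s + m)} (separated ((s + m) mod n))
          (+-monoʳ-< s p<q) (+-monoʳ-< s q<r) (+-monoʳ-< s r<t)
          (<-≤-trans (+-monoʳ-< s t<n) (+-monoˡ-≤ n (m≤m+n s p))))
        (d + l) rest rest≡ (λ {m} _ → dense {m}) (λ {m} _ → sparse {m})
        d overfull-nonempty initial d-leaves final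
      sorted-at : ∀ i {p q} → s ≤ p → p < q → q < s + n → (set N i ⊖ X) p → ¬ (X ⊖ set N i) q
      sorted-at i {p} {q} s≤p p<q q<s+n
        with m , s≤m , m<s+n , refl ← lift s i
        with m′ , refl ← m≤n⇒∃[o]m+o≡n s≤m
        with p′ , refl ← m≤n⇒∃[o]m+o≡n s≤p
        with q′ , refl ← m≤n⇒∃[o]m+o≡n (≤-trans s≤p (<⇒≤ p<q))
        = E.sorted (<⇒≤ (+-cancelˡ-< s m′ n m<s+n)) (+-cancelˡ-< s p′ q′ p<q) (+-cancelˡ-< s q′ n q<s+n)

    exterior-sorted : ¬ (∀ i → set N i ≪[ i ] X) → ∃ λ s → ∀ i → X ≪[ s mod n ] set N i
    exterior-sorted ¬≪ with a , l , l≤n , over ← overfull ¬≪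
                       with b , k , k≤l , over′ , xb , leaves ← overfull-shrink l over =
      exterior-sorted-at (≤-trans k≤l l≤n) over′ xb leaves

  -- Passing from the necklace to a set in its interior.

  ≪-through : ∀ {X Y} s → Layer r Y → (∀ i → X ≪[ s mod n ] set N i) → (∀ i → set N i ≪[ i ] Y) →
              X ≪[ s mod n ] Y
  ≪-through {X} {Y} s size X≪ ≪Y = sorted⇒≪ {X = X} {Z = Y} s sorted
    where
    sorted : ∀ {u v} → s ≤ u → u < v → v < s + n → (Y ⊖ X) u → ¬ (X ⊖ Y) v
    sorted {u} {v} s≤u u<v v<s+n (yu , xu) (xv , yv) with v<u+n ← <-≤-trans v<s+n (+-monoˡ-≤ n s≤u)
      with j , 1+v+j≡u+n ← m≤n⇒∃[o]m+o≡n v<u+n =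
      -- Time `u + n` is time `u` again, when `u` is present by `own`.
      false≢true (proj₁ (absent j (≤-reflexive 1+v+j≡u+n)))
        (trans (cong (_‼ u) (trans (cong time 1+v+j≡u+n) (time-+n u))) (time-own u))
      where
      u⇒v : ∀ i → set N i ‼ u ≡ true → set N i ‼ v ≡ true
      u⇒v i nu with true-or-false (set N i ‼ v)
      ... | inj₁ nv = nv
      ... | inj₂ nv = ⊥-elim (≪⇒sorted {X = X} {Z = set N i} (X≪ i) s≤u u<v v<s+n (nu , xu) (xv , nv))
      -- For these times the window from `m` meets `u` before `v`, as `u + n` and `v + n`, so `≪Y`
      -- applies.
      v⇒u : ∀ {m} → v < m → m ≤ u + n → time m ‼ v ≡ true → time m ‼ u ≡ true
      v⇒u {m} v<m m≤u+n nv with true-or-false (time m ‼ u)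
      ... | inj₁ nu = nu
      ... | inj₂ nu = ⊥-elim (≪⇒sorted {X = time m} {Z = Y} (≪Y (m mod n)) m≤u+n (+-monoˡ-< n u<v) (+-monoˡ-< n v<m)
              (⊖-+n Y (time m) (yu , nu)) (⊖-+n (time m) Y (nv , yv)))
      v-leaves : ¬ time (suc v) ‼ v ≡ true
      -- In the order from `v + 1`, `v` comes last, as `v + n`. Were it in `time (suc v) ⊖ Y`, equal
      -- sizes would put an element of `Y ⊖ time (suc v)` before it.
      v-leaves nv with hv ← ⊖-+n (time (suc v)) Y (nv , yv)
        with z , i , hz ← count-≤⇒∃ (≤-reflexive (sym (count-layer Y (suc v) (suc v mod n) size)))
                            (inRange (m<m+n v (>-nonZero⁻¹ n)) (n<1+n (v + n))) hv =
        ≪⇒sorted {X = time (suc v)} {Z = Y} (≪Y (suc v mod n)) (lower i)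
          (≤∧≢⇒< (s≤s⁻¹ (upper i)) λ { refl → false≢true (proj₂ hv) (proj₁ hz) }) (n<1+n (v + n)) hz hv
      absent : ∀ j → let m = suc v + j in m ≤ u + n → time m ‼ u ≡ false × time m ‼ v ≡ false
      absent zero _ rewrite +-identityʳ v =
        ≢true⇒false (λ nu → v-leaves (u⇒v _ nu)) , ≢true⇒false v-leaves
      absent (suc j) m<u+n rewrite +-suc v j
        with nu , nv ← absent j (<⇒≤ m<u+n) =
          ¬u , ≢true⇒false λ nv′ → false≢true ¬u (v⇒u (s≤s (m≤n⇒m≤1+n (m≤m+n v j))) m<u+n nv′)
        where
        -- If `u` entered, `u⇒v` would make `v` enter in the same step, giving two gains at once.
        ¬u = ≢true⇒false λ nu′ → mod-injective u<v v<u+n (gain-unique (nu′ , nu) (u⇒v _ nu′ , nv))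

theorem3 : ∀ (n r : ℕ) .{{_ : NonZero n}} (N : Necklace n r) →
    (∀ i → i ∈ set N i) →
    ∀ (X Y : Subset n) → Out N X → Int N Y → X ∥ Y
theorem3 n r N own X Y ((size , separated) , X∉Int) (Y-size , ≪Y)
  with s , X≪ ← exterior-sorted N own size separated (λ ≪X → X∉Int (size , ≪X)) =
  s mod n , ≪-through N own s Y-size X≪ ≪Y
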